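{- For all integers $p \ge 6$ and $q \ge 5$, $$r_4(p,q) \ge 2\, r_4(p-1,q) - 1.$$ Furthermore, for all integers $p \ge 6$ and $q \ge 7$, $$r_4(p,q) \ge (p-1)\cdot\bigl(r_4(p-1,q)-1\bigr) + 1.$$
   Context: For integers $k,p,q$, the Ramsey number $r_k(p,q)$ is the smallest integer $N$ such that for every coloring of all $k$-element subsets of $\{1,\dots,N\}$ with the colors red and blue, there exist either $p$ elements of $\{1,\dots,N\}$ all of whose $k$-element subsets are red, or $q$ elements of $\{1,\dots,N\}$ all of whose $k$-element subsets are blue. -}

module Defs where

open import Data.Fin.Subset using (Subset; ∣_∣; _⊆_)
open import Data.Nat using (ℕ; _≤_)
open import Data.Product using (Σ-syntax; ∃-syntax; _×_; proj₁)
open import Data.Sum using (_⊎_)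
open import Relation.Binary.PropositionalEquality using (_≡_)

data Colour : Set where
  red blue : Colour

KSubset : ℕ → ℕ → Set
KSubset k N = Σ[ S ∈ Subset N ] ∣ S ∣ ≡ k

Colouring : ℕ → ℕ → Set
Colouring k N = KSubset k N → Colour

HasMonochromatic : ∀ {k N} → Colouring k N → Colour → ℕ → Set
HasMonochromatic {k} {N} c χ m =
  ∃[ X ] ∣ X ∣ ≡ m × ((e : KSubset k N) → proj₁ e ⊆ X → c e ≡ χ)

RamseyProperty : ℕ → ℕ → ℕ → ℕ → Set
RamseyProperty k p q N =
  (c : Colouring k N) → HasMonochromatic c red p ⊎ HasMonochromatic c blue q

-- IsRamseyNumber k p q N says r_k(p,q) = N.  The Ramsey number is given by its
-- graph: as a function it would need a proof of Ramsey's theorem.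
IsRamseyNumber : ℕ → ℕ → ℕ → ℕ → Set
IsRamseyNumber k p q N =
  RamseyProperty k p q N × (∀ M → RamseyProperty k p q M → N ≤ M)

{-# OPTIONS --safe #-}
module Submission where

-- The lower bound comes from a product colouring.  Take a colouring c of the
-- 4-subsets of an n-set and m disjoint copies of that n-set, the fibres, and
-- colour a 4-subset of the union of the copies as follows:
--   * if some fibre contains exactly two of its points, it is blue;
--   * if it lies inside one fibre, it gets the colour given by c;
--   * otherwise (it splits as 3 + 1 or as 1 + 1 + 1 + 1) it is red.
--
-- A red set X with p > m points has two points in some fibre, by pigeonhole.
-- If two points of X lay outside that fibre, the four points would form a blue
-- 4-subset; so p - 1 points of X lie in that fibre, and they form a red set
-- for c (red-descends).
--
-- A blue set X with q points that has three points in a fibre lies inside that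
-- fibre, since a point outside would give a red 4-subset of type 3 + 1; so X
-- is a blue set for c.  If instead X has at most two points in every fibre,
-- then q is at most 2m, and q is at most 6, since seven points would contain
-- four in distinct fibres, which form a red 4-subset (blue-descends).
--
-- Hence, if m < p and either q > 2m or q is at least 7, the Ramsey property
-- for (p, q) on at most m * n points implies the Ramsey property for
-- (p - 1, q) on n points (ramsey-descends).  With n one less than the Ramsey
-- number for (p - 1, q), the conclusion fails, so the Ramsey number for (p, q)
-- is larger than m * n.  The two inequalities are the cases m = 2 and
-- m = p - 1.

open import Data.Empty using (⊥-elim)
open import Data.Fin using (Fin; zero; suc; inject≤; remQuot; combine)
open import Data.Fin.Properties
  using (any?; combine-remQuot; inject≤-injective; suc-injective)
  renaming (_≟_ to _≟ᶠ_)
open import Data.Fin.Subset hiding (⊤)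
open import Data.Fin.Subset.Properties
open import Data.Nat
  using (ℕ; zero; suc; _+_; _*_; _∸_; _≤_; _<_; _≥_; z≤n; s≤s)
  renaming (_≟_ to _≟ⁿ_)
open import Data.Nat.Properties hiding (suc-injective)
open import Data.Product using (∃; ∃-syntax; _×_; _,_; proj₁; proj₂; uncurry)
open import Data.Sum using (_⊎_; inj₁; inj₂; [_,_]′)
open import Data.Vec using ([]; _∷_; here; there; tabulate)
open import Data.Vec.Properties
  using (lookup⇒[]=; []=⇒lookup; lookup∘tabulate)
open import Function using (_∘_; id)
open import Relation.Binary.PropositionalEquality
open import Relation.Nullary using (¬_; yes; no; does; contradiction)
open import Relation.Nullary.Decidable using (dec-true)
open import Relation.Unary using (Pred; Decidable)

open import Defs

private
  variable
    k n N : ℕ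

-- Sizes of finite subsets

∈-─⁻ : ∀ (S P : Subset N) {x} → x ∈ S ─ P → x ∉ P
∈-─⁻ (_ ∷ S) (outside ∷ P) (there x∈) (there x∈P) = ∈-─⁻ S P x∈ x∈P
∈-─⁻ (_ ∷ S) (inside  ∷ P) (there x∈) (there x∈P) = ∈-─⁻ S P x∈ x∈P

∣S∣-split : ∀ (S P : Subset N) → ∣ S ∣ ≡ ∣ S ∩ P ∣ + ∣ S ─ P ∣
∣S∣-split []            []            = refl
∣S∣-split (outside ∷ S) (outside ∷ P) = ∣S∣-split S P
∣S∣-split (outside ∷ S) (inside  ∷ P) = ∣S∣-split S P
∣S∣-split (inside  ∷ S) (outside ∷ P) =
  trans (cong suc (∣S∣-split S P)) (sym (+-suc ∣ S ∩ P ∣ ∣ S ─ P ∣))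
∣S∣-split (inside  ∷ S) (inside  ∷ P) = cong suc (∣S∣-split S P)

∣∪∣-disjoint : ∀ (S U : Subset N) → (∀ {x} → x ∈ S → x ∉ U) →
               ∣ S ∪ U ∣ ≡ ∣ S ∣ + ∣ U ∣
∣∪∣-disjoint []            []            _ = refl
∣∪∣-disjoint (outside ∷ S) (outside ∷ U) d =
  ∣∪∣-disjoint S U λ x∈S x∈U → d (there x∈S) (there x∈U)
∣∪∣-disjoint (outside ∷ S) (inside  ∷ U) d =
  trans (cong suc (∣∪∣-disjoint S U λ x∈S x∈U → d (there x∈S) (there x∈U)))
        (sym (+-suc ∣ S ∣ ∣ U ∣))
∣∪∣-disjoint (inside  ∷ S) (outside ∷ U) d =
  cong suc (∣∪∣-disjoint S U λ x∈S x∈U → d (there x∈S) (there x∈U))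
∣∪∣-disjoint (inside  ∷ S) (inside  ∷ U) d = contradiction here (d here)

∣⁅x⁆∪S∣ : ∀ {x} (S : Subset N) → x ∉ S → ∣ ⁅ x ⁆ ∪ S ∣ ≡ suc ∣ S ∣
∣⁅x⁆∪S∣ {x = x} S x∉S = trans
  (∣∪∣-disjoint ⁅ x ⁆ S
    λ y∈ y∈S → x∉S (subst (_∈ S) (x∈⁅y⁆⇒x≡y x y∈) y∈S))
  (cong (_+ ∣ S ∣) (∣⁅x⁆∣≡1 x))

nonempty : ∀ (S : Subset N) → 0 < ∣ S ∣ → Nonempty S
nonempty {N} S 0<∣S∣ with nonempty? S
... | yes ne = ne
... | no  e  = contradiction
  (trans (cong ∣_∣ (Empty-unique e)) (∣⊥∣≡0 N)) (>⇒≢ 0<∣S∣)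

∪-⊆ : ∀ (S U : Subset N) {X : Subset N} → S ⊆ X → U ⊆ X → S ∪ U ⊆ X
∪-⊆ S U S⊆X U⊆X = [ S⊆X , U⊆X ]′ ∘ x∈p∪q⁻ S U

⁅⁆-⊆ : ∀ {x} {X : Subset N} → x ∈ X → ⁅ x ⁆ ⊆ X
⁅⁆-⊆ {x = x} {X} x∈X y∈ = subst (_∈ X) (sym (x∈⁅y⁆⇒x≡y x y∈)) x∈X

subset-of-size : ∀ k (X : Subset N) → k ≤ ∣ X ∣ → ∃[ S ] S ⊆ X × ∣ S ∣ ≡ k
subset-of-size {N} zero X _ = ⊥ , ⊥⊆ , ∣⊥∣≡0 N
subset-of-size (suc k) (outside ∷ X) k≤
  with S , S⊆X , ∣S∣≡k ← subset-of-size (suc k) X k≤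
  = outside ∷ S , s⊆s S⊆X , ∣S∣≡k
subset-of-size (suc k) (inside ∷ X) (s≤s k≤)
  with S , S⊆X , ∣S∣≡k ← subset-of-size k X k≤
  = inside ∷ S , s⊆s S⊆X , cong suc ∣S∣≡k

-- The pigeonhole principle: m sets that cover X and meet it in at most b
-- points each.
∣X∣≤m*b : ∀ m b (P : Fin m → Subset N) (X : Subset N) →
          (∀ {x} → x ∈ X → ∃ λ i → x ∈ P i) →
          (∀ i → ∣ X ∩ P i ∣ ≤ b) → ∣ X ∣ ≤ m * b
∣X∣≤m*b zero b P X cover _ with nonempty? X
... | yes (x , x∈X) with () ← proj₁ (cover x∈X)
∣X∣≤m*b {N} zero b P X cover _ | no e =
  ≤-reflexive (trans (cong ∣_∣ (Empty-unique e)) (∣⊥∣≡0 N))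
∣X∣≤m*b {N} (suc m) b P X cover few = begin
  ∣ X ∣                            ≡⟨ ∣S∣-split X (P zero) ⟩
  ∣ X ∩ P zero ∣ + ∣ X ─ P zero ∣  ≤⟨ +-mono-≤ (few zero) rest ⟩
  b + m * b                        ∎
  where
  open ≤-Reasoning
  X′ : Subset N
  X′ = X ─ P zero

  cover′ : ∀ {x} → x ∈ X′ → ∃ λ i → x ∈ P (suc i)
  cover′ x∈ with cover (p─q⊆p X (P zero) x∈)
  ... | zero  , x∈P₀ = contradiction x∈P₀ (∈-─⁻ X (P zero) x∈)
  ... | suc i , x∈Pᵢ = i , x∈Pᵢ

  few′ : ∀ i → ∣ X′ ∩ P (suc i) ∣ ≤ b
  few′ i = ≤-trans (p⊆q⇒∣p∣≤∣q∣ λ x∈ →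
    let x∈X′ , x∈Pᵢ = x∈p∩q⁻ X′ (P (suc i)) x∈
    in  x∈p∩q⁺ (p─q⊆p X (P zero) x∈X′ , x∈Pᵢ)) (few (suc i))

  rest : ∣ X′ ∣ ≤ m * b
  rest = ∣X∣≤m*b m b (P ∘ suc) X′ cover′ few′

-- Subsets from predicates, and images

module _ {ℓ} {P : Pred (Fin N) ℓ} (P? : Decidable P) where

  -- The subset of the points that satisfy P.
  comprehension : Subset N
  comprehension = tabulate λ x → does (P? x)

  ∈-comprehension⁺ : ∀ {x} → P x → x ∈ comprehension
  ∈-comprehension⁺ {x} px = lookup⇒[]= x _
    (trans (lookup∘tabulate _ x) (dec-true (P? x) px))

  ∈-comprehension⁻ : ∀ {x} → x ∈ comprehension → P x
  ∈-comprehension⁻ {x} x∈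
    with P? x | trans (sym (lookup∘tabulate (λ y → does (P? y)) x)) ([]=⇒lookup x∈)
  ... | yes px | _ = px
  ... | no  _  | ()

-- The direct image of a subset, by recursion on its characteristic vector.
image : (Fin N → Fin n) → Subset N → Subset n
image f []            = ⊥
image f (outside ∷ S) = image (f ∘ suc) S
image f (inside  ∷ S) = ⁅ f zero ⁆ ∪ image (f ∘ suc) S

∈-image⁺ : ∀ (f : Fin N → Fin n) {S x} → x ∈ S → f x ∈ image f S
∈-image⁺ f {inside  ∷ S} here       = p⊆p∪q _ (x∈⁅x⁆ (f zero))
∈-image⁺ f {outside ∷ S} (there x∈) = ∈-image⁺ (f ∘ suc) x∈
∈-image⁺ f {inside  ∷ S} (there x∈) = q⊆p∪q _ _ (∈-image⁺ (f ∘ suc) x∈)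

∈-image⁻ : ∀ (f : Fin N → Fin n) S {y} → y ∈ image f S →
           ∃[ x ] x ∈ S × f x ≡ y
∈-image⁻ f [] y∈ = contradiction y∈ ∉⊥
∈-image⁻ f (outside ∷ S) y∈ with x , x∈S , eq ← ∈-image⁻ (f ∘ suc) S y∈
  = suc x , there x∈S , eq
∈-image⁻ f (inside ∷ S) y∈ with x∈p∪q⁻ ⁅ f zero ⁆ _ y∈
... | inj₁ y∈₀ = zero , here , sym (x∈⁅y⁆⇒x≡y _ y∈₀)
... | inj₂ y∈₁ with x , x∈S , eq ← ∈-image⁻ (f ∘ suc) S y∈₁
  = suc x , there x∈S , eq

-- Injectivity of f restricted to S.
InjectiveOn : (Fin N → Fin n) → Subset N → Set
InjectiveOn f S = ∀ {x y} → x ∈ S → y ∈ S → f x ≡ f y → x ≡ y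

∣image∣ : ∀ (f : Fin N → Fin n) S → InjectiveOn f S → ∣ image f S ∣ ≡ ∣ S ∣
∣image∣ {n = n} f [] _ = ∣⊥∣≡0 n
∣image∣ f (outside ∷ S) inj = ∣image∣ (f ∘ suc) S
  λ x∈ y∈ eq → suc-injective (inj (there x∈) (there y∈) eq)
∣image∣ f (inside ∷ S) inj = trans
  (∣⁅x⁆∪S∣ (image (f ∘ suc) S) f₀∉)
  (cong suc (∣image∣ (f ∘ suc) S
    λ x∈ y∈ eq → suc-injective (inj (there x∈) (there y∈) eq)))
  where
  f₀∉ : f zero ∉ image (f ∘ suc) S
  f₀∉ f₀∈ with x , x∈S , eq ← ∈-image⁻ (f ∘ suc) S f₀∈
          with () ← inj (there x∈S) here eq

KSubset-≡ : ∀ {e e′ : KSubset k N} → proj₁ e ≡ proj₁ e′ → e ≡ e′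
KSubset-≡ {e = S , s} {.S , s′} refl = cong (S ,_) (≡-irrelevant s s′)

-- The product colouring

-- The N vertices are placed injectively in m copies of an n-set: vertex x is
-- the point pos x of copy number part x.
module Product {m n N : ℕ} (part : Fin N → Fin m) (pos : Fin N → Fin n)
  (part-pos-injective : ∀ {x y} → part x ≡ part y → pos x ≡ pos y → x ≡ y)
  (c : Colouring 4 n) where

  -- The set of vertices in copy number i.
  fibre : Fin m → Subset N
  fibre i = comprehension λ x → part x ≟ᶠ i

  ∈-fibre⁺ : ∀ {x i} → part x ≡ i → x ∈ fibre i
  ∈-fibre⁺ {i = i} = ∈-comprehension⁺ λ x → part x ≟ᶠ i

  ∈-fibre⁻ : ∀ {x i} → x ∈ fibre i → part x ≡ i
  ∈-fibre⁻ {i = i} = ∈-comprehension⁻ λ x → part x ≟ᶠ i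

  pos-injective : ∀ {i S} → S ⊆ fibre i → InjectiveOn pos S
  pos-injective S⊆ x∈ y∈ =
    part-pos-injective (trans (∈-fibre⁻ (S⊆ x∈)) (sym (∈-fibre⁻ (S⊆ y∈))))

  ∣image-pos∣ : ∀ {i} S → S ⊆ fibre i → ∣ image pos S ∣ ≡ ∣ S ∣
  ∣image-pos∣ S S⊆ = ∣image∣ pos S (pos-injective S⊆)

  -- Two points exactly in some fibre: blue; all points in one fibre: as in c;
  -- otherwise red.
  colour : Colouring 4 N
  colour (S , ∣S∣≡4) with any? (λ i → ∣ S ∩ fibre i ∣ ≟ⁿ 2)
  ... | yes _ = blue
  ... | no  _ with any? (λ i → S ⊆? fibre i)
  ...   | yes (_ , S⊆) = c (image pos S , trans (∣image-pos∣ S S⊆) ∣S∣≡4)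
  ...   | no  _        = red

  colour-pair : ∀ e i → ∣ proj₁ e ∩ fibre i ∣ ≡ 2 → colour e ≡ blue
  colour-pair (S , _) i two with any? (λ i → ∣ S ∩ fibre i ∣ ≟ⁿ 2)
  ... | yes _    = refl
  ... | no  none = contradiction (i , two) none

  colour-spread : ∀ e → (∀ i → ∣ proj₁ e ∩ fibre i ∣ ≢ 2) →
                  (∀ i → ¬ proj₁ e ⊆ fibre i) → colour e ≡ red
  colour-spread (S , _) no-pair not-inside
    with any? (λ i → ∣ S ∩ fibre i ∣ ≟ⁿ 2)
  ... | yes (i , two) = contradiction two (no-pair i)
  ... | no  _ with any? (λ i → S ⊆? fibre i)
  ...   | yes (i , S⊆) = ⊥-elim (not-inside i S⊆)
  ...   | no  _        = refl

  -- Two points of S in a fibre j force j to be the fibre i that contains S,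
  -- and then S would have two points instead of four.
  colour-inside : ∀ (e : KSubset 4 N) (e′ : KSubset 4 n) {i} →
                  proj₁ e ⊆ fibre i → image pos (proj₁ e) ≡ proj₁ e′ →
                  colour e ≡ c e′
  colour-inside (S , ∣S∣≡4) e′ {i} S⊆ im≡
    with any? (λ j → ∣ S ∩ fibre j ∣ ≟ⁿ 2)
  ... | no _ with any? (λ j → S ⊆? fibre j)
  ...   | yes _          = cong c (KSubset-≡ im≡)
  ...   | no  not-inside = ⊥-elim (not-inside (i , S⊆))
  colour-inside (S , ∣S∣≡4) e′ {i} S⊆ im≡ | yes (j , two) =
    contradiction (≤-trans (≤-reflexive (sym ∣S∣≡4))
                    (≤-trans (p⊆q⇒∣p∣≤∣q∣ S⊆S∩fⱼ) (≤-reflexive two)))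
                  λ where (s≤s (s≤s ()))
    where
    i≡j : i ≡ j
    i≡j with x , x∈ ← nonempty (S ∩ fibre j) (subst (0 <_) (sym two) (s≤s z≤n))
        with x∈S , x∈fⱼ ← x∈p∩q⁻ S (fibre j) x∈
        = trans (sym (∈-fibre⁻ (S⊆ x∈S))) (∈-fibre⁻ x∈fⱼ)

    S⊆S∩fⱼ : S ⊆ S ∩ fibre j
    S⊆S∩fⱼ x∈S = x∈p∩q⁺ (x∈S , subst (λ h → _ ∈ fibre h) i≡j (S⊆ x∈S))

  -- X spans only 4-subsets of colour χ in the product colouring.
  Mono : Colour → Subset N → Set
  Mono χ X = (e : KSubset 4 N) → proj₁ e ⊆ X → colour e ≡ χ

  Mono-⊆ : ∀ {χ X Y} → Y ⊆ X → Mono χ X → Mono χ Y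
  Mono-⊆ Y⊆X mono e e⊆Y = mono e (Y⊆X ∘ e⊆Y)

  -- On a single fibre the product colouring is a copy of c: a 4-subset E of the
  -- image of A is the image of the 4-subset of A lying over it.
  mono-in-fibre : ∀ {χ i} A → A ⊆ fibre i → Mono χ A →
                  HasMonochromatic c χ ∣ A ∣
  mono-in-fibre {χ} {i} A A⊆ mono = image pos A , ∣image-pos∣ A A⊆ , mono′
    where
    mono′ : (e : KSubset 4 n) → proj₁ e ⊆ image pos A → c e ≡ χ
    mono′ e@(E , ∣E∣≡4) E⊆ =
      trans (sym (colour-inside (S , ∣S∣≡4) e S⊆ im≡E)) (mono (S , ∣S∣≡4) S⊆A)
      where
      pre : Subset N
      pre = comprehension λ x → pos x ∈? E

      S : Subset N
      S = A ∩ pre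

      S⊆A : S ⊆ A
      S⊆A = p∩q⊆p A pre

      S⊆ : S ⊆ fibre i
      S⊆ x∈ = A⊆ (S⊆A x∈)

      im⊆E : image pos S ⊆ E
      im⊆E y∈ with x , x∈S , refl ← ∈-image⁻ pos S y∈ =
        ∈-comprehension⁻ (λ x → pos x ∈? E) (p∩q⊆q A pre x∈S)

      E⊆im : E ⊆ image pos S
      E⊆im y∈E with x , x∈A , refl ← ∈-image⁻ pos A (E⊆ y∈E) =
        ∈-image⁺ pos
          (x∈p∩q⁺ (x∈A , ∈-comprehension⁺ (λ x → pos x ∈? E) y∈E))

      im≡E : image pos S ≡ E
      im≡E = ⊆-antisym im⊆E E⊆im

      ∣S∣≡4 : ∣ S ∣ ≡ 4
      ∣S∣≡4 = trans (sym (∣image-pos∣ S S⊆)) (trans (cong ∣_∣ im≡E) ∣E∣≡4)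

  crowded-fibre : ∀ b X → (∃ λ i → b < ∣ X ∩ fibre i ∣) ⊎
                          (∀ i → ∣ X ∩ fibre i ∣ ≤ b)
  crowded-fibre b X with any? (λ i → b <? ∣ X ∩ fibre i ∣)
  ... | yes crowded = inj₁ crowded
  ... | no  none    = inj₂ λ i → ≮⇒≥ λ b< → none (i , b<)

  few-points : ∀ b X → (∀ i → ∣ X ∩ fibre i ∣ ≤ b) → ∣ X ∣ ≤ m * b
  few-points b X = ∣X∣≤m*b m b fibre X λ {x} _ → part x , ∈-fibre⁺ refl

  -- Two points in a fibre and two points outside it form a blue 4-subset.
  red-outside : ∀ {X} i → Mono red X → 2 ≤ ∣ X ∩ fibre i ∣ →
                    ∣ X ─ fibre i ∣ < 2
  red-outside {X} i mono two = ≰⇒> λ two′ →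
    let A , A⊆ , ∣A∣≡2 = subset-of-size 2 (X ∩ fibre i) two
        B , B⊆ , ∣B∣≡2 = subset-of-size 2 (X ─ fibre i) two′
        outside-fibre : ∀ {x} → x ∈ B → x ∉ fibre i
        outside-fibre x∈B = ∈-─⁻ X (fibre i) (B⊆ x∈B)
        inside-fibre : A ⊆ fibre i
        inside-fibre x∈A = p∩q⊆q X (fibre i) (A⊆ x∈A)
        ∣A∪B∣≡4 : ∣ A ∪ B ∣ ≡ 4
        ∣A∪B∣≡4 = trans
          (∣∪∣-disjoint A B λ x∈A x∈B → outside-fibre x∈B (inside-fibre x∈A))
          (cong₂ _+_ ∣A∣≡2 ∣B∣≡2)
        ∩≡A : (A ∪ B) ∩ fibre i ≡ A
        ∩≡A = ⊆-antisym
          (λ x∈ → let x∈∪ , x∈f = x∈p∩q⁻ (A ∪ B) (fibre i) x∈ in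
            [ id , (λ x∈B → contradiction x∈f (outside-fibre x∈B)) ]′
              (x∈p∪q⁻ A B x∈∪))
          (λ x∈A → x∈p∩q⁺ (p⊆p∪q B x∈A , inside-fibre x∈A))
        is-red  = mono (A ∪ B , ∣A∪B∣≡4)
          (∪-⊆ A B (λ x∈ → p∩q⊆p X (fibre i) (A⊆ x∈))
                   (λ x∈ → p─q⊆p X (fibre i) (B⊆ x∈)))
        is-blue = colour-pair (A ∪ B , ∣A∪B∣≡4) i (trans (cong ∣_∣ ∩≡A) ∣A∣≡2)
    in  contradiction (trans (sym is-red) is-blue) λ ()

  red-descends : ∀ p → m ≤ p → HasMonochromatic colour red (suc p) →
                 HasMonochromatic c red p
  red-descends p m≤p (X , ∣X∣≡1+p , mono) with crowded-fibre 1 X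
  ... | inj₂ few = contradiction
    (≤-trans (≤-reflexive (sym ∣X∣≡1+p)) (≤-trans (few-points 1 X few)
      (≤-trans (≤-reflexive (*-identityʳ m)) m≤p)))
    (n≮n p)
  ... | inj₁ (i , two) =
    let A , A⊆ , ∣A∣≡p = subset-of-size p (X ∩ fibre i) p≤
    in  subst (HasMonochromatic c red) ∣A∣≡p
          (mono-in-fibre A (λ x∈ → p∩q⊆q X (fibre i) (A⊆ x∈))
            (Mono-⊆ (λ x∈ → p∩q⊆p X (fibre i) (A⊆ x∈)) mono))
    where
    open ≤-Reasoning
    p≤ : p ≤ ∣ X ∩ fibre i ∣
    p≤ = ≤-pred (begin
      suc p                              ≡⟨ ∣X∣≡1+p ⟨
      ∣ X ∣                              ≡⟨ ∣S∣-split X (fibre i) ⟩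
      ∣ X ∩ fibre i ∣ + ∣ X ─ fibre i ∣
        ≤⟨ +-monoʳ-≤ _ (≤-pred (red-outside i mono two)) ⟩
      ∣ X ∩ fibre i ∣ + 1                ≡⟨ +-comm _ 1 ⟩
      suc ∣ X ∩ fibre i ∣                ∎)

  -- Three points in a fibre and a point u outside it form a red 4-subset, as
  -- the fibres meet it in 3, 1 or 0 points.
  blue-inside : ∀ {X} i → Mono blue X → 3 ≤ ∣ X ∩ fibre i ∣ → X ⊆ fibre i
  blue-inside {X} i mono three {u} u∈X with u ∈? fibre i
  ... | yes u∈f = u∈f
  ... | no  u∉f with A , A⊆ , ∣A∣≡3 ← subset-of-size 3 (X ∩ fibre i) three =
    contradiction (trans (sym is-red) is-blue) λ ()
    where
    A⊆f : A ⊆ fibre i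
    A⊆f x∈A = p∩q⊆q X (fibre i) (A⊆ x∈A)

    S : Subset N
    S = ⁅ u ⁆ ∪ A

    ∣S∣≡4 : ∣ S ∣ ≡ 4
    ∣S∣≡4 = trans (∣⁅x⁆∪S∣ A (u∉f ∘ A⊆f)) (cong suc ∣A∣≡3)

    ∩≡A : S ∩ fibre i ≡ A
    ∩≡A = ⊆-antisym
      (λ x∈ → let x∈S , x∈f = x∈p∩q⁻ S (fibre i) x∈ in
        [ (λ x∈u → contradiction
             (subst (_∈ fibre i) (x∈⁅y⁆⇒x≡y u x∈u) x∈f) u∉f) , id ]′
          (x∈p∪q⁻ ⁅ u ⁆ A x∈S))
      (λ x∈A → x∈p∩q⁺ (q⊆p∪q ⁅ u ⁆ A x∈A , A⊆f x∈A))

    no-pair : ∀ j → ∣ S ∩ fibre j ∣ ≢ 2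
    no-pair j two with i ≟ᶠ j
    ... | yes refl =
      contradiction (trans (sym two) (trans (cong ∣_∣ ∩≡A) ∣A∣≡3)) λ ()
    ... | no  i≢j = contradiction
      (≤-trans (≤-reflexive (sym two))
        (≤-trans (p⊆q⇒∣p∣≤∣q∣ ∩⊆u) (≤-reflexive (∣⁅x⁆∣≡1 u))))
      (n≮n 1)
      where
      ∩⊆u : S ∩ fibre j ⊆ ⁅ u ⁆
      ∩⊆u x∈ = let x∈S , x∈f = x∈p∩q⁻ S (fibre j) x∈ in
        [ id , (λ x∈A → contradiction
                 (trans (sym (∈-fibre⁻ (A⊆f x∈A))) (∈-fibre⁻ x∈f)) i≢j) ]′
          (x∈p∪q⁻ ⁅ u ⁆ A x∈S)

    not-inside : ∀ j → ¬ S ⊆ fibre j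
    not-inside j S⊆
      with a , a∈A ← nonempty A (subst (0 <_) (sym ∣A∣≡3) (s≤s z≤n)) =
      u∉f (∈-fibre⁺ (trans
        (∈-fibre⁻ (S⊆ (p⊆p∪q A (x∈⁅x⁆ u))))
        (trans (sym (∈-fibre⁻ (S⊆ (q⊆p∪q ⁅ u ⁆ A a∈A)))) (∈-fibre⁻ (A⊆f a∈A)))))

    is-red : colour (S , ∣S∣≡4) ≡ red
    is-red = colour-spread (S , ∣S∣≡4) no-pair not-inside

    is-blue : colour (S , ∣S∣≡4) ≡ blue
    is-blue = mono (S , ∣S∣≡4)
      (∪-⊆ ⁅ u ⁆ A (⁅⁆-⊆ u∈X) (λ x∈ → p∩q⊆p X (fibre i) (A⊆ x∈)))

  -- Points of X in distinct fibres, chosen greedily: every chosen point excludes at most two points, those in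
  -- its own fibre.
  transversal : ∀ k X → (∀ i → ∣ X ∩ fibre i ∣ ≤ 2) → k * 2 ≤ suc ∣ X ∣ →
                ∃[ S ] S ⊆ X × ∣ S ∣ ≡ k × (∀ i → ∣ S ∩ fibre i ∣ ≤ 1)
  transversal zero X few _ =
    ⊥ , ⊥⊆ , ∣⊥∣≡0 N , λ i →
      ≤-trans (∣p∩q∣≤∣p∣ ⊥ (fibre i)) (≤-trans (≤-reflexive (∣⊥∣≡0 N)) z≤n)
  transversal (suc k) X few 2+2k≤
    with x , x∈X ← nonempty X (≤-pred (≤-trans (s≤s (s≤s z≤n)) 2+2k≤)) =
    extend (transversal k X′ few′ 2k≤)
    where
    F : Subset N
    F = fibre (part x)

    X′ : Subset N
    X′ = X ─ F

    few′ : ∀ i → ∣ X′ ∩ fibre i ∣ ≤ 2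
    few′ i = ≤-trans (p⊆q⇒∣p∣≤∣q∣ λ y∈ →
      let y∈X′ , y∈f = x∈p∩q⁻ X′ (fibre i) y∈
      in  x∈p∩q⁺ (p─q⊆p X F y∈X′ , y∈f)) (few i)

    2k≤ : k * 2 ≤ suc ∣ X′ ∣
    2k≤ = +-cancelˡ-≤ 2 _ _ (begin
      2 + k * 2                   ≤⟨ 2+2k≤ ⟩
      suc ∣ X ∣                   ≡⟨ cong suc (∣S∣-split X F) ⟩
      suc (∣ X ∩ F ∣ + ∣ X′ ∣)    ≤⟨ s≤s (+-monoˡ-≤ ∣ X′ ∣ (few (part x))) ⟩
      2 + suc ∣ X′ ∣              ∎)
      where open ≤-Reasoning

    extend : (∃[ S ] S ⊆ X′ × ∣ S ∣ ≡ k × (∀ i → ∣ S ∩ fibre i ∣ ≤ 1)) →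
             ∃[ S ] S ⊆ X × ∣ S ∣ ≡ suc k × (∀ i → ∣ S ∩ fibre i ∣ ≤ 1)
    extend (S , S⊆X′ , ∣S∣≡k , thin) =
      ⁅ x ⁆ ∪ S ,
      ∪-⊆ ⁅ x ⁆ S (⁅⁆-⊆ x∈X) (λ y∈ → p─q⊆p X F (S⊆X′ y∈)) ,
      trans (∣⁅x⁆∪S∣ S λ x∈S → S∩F-empty x∈S (∈-fibre⁺ refl)) (cong suc ∣S∣≡k) ,
      thin′
      where
      S∩F-empty : ∀ {y} → y ∈ S → y ∉ F
      S∩F-empty y∈S = ∈-─⁻ X F (S⊆X′ y∈S)

      thin′ : ∀ i → ∣ (⁅ x ⁆ ∪ S) ∩ fibre i ∣ ≤ 1
      thin′ i with part x ≟ᶠ i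
      ... | yes refl = ≤-trans (p⊆q⇒∣p∣≤∣q∣ λ y∈ →
              let y∈∪ , y∈f = x∈p∩q⁻ (⁅ x ⁆ ∪ S) (fibre i) y∈ in
              [ id , (λ y∈S → contradiction y∈f (S∩F-empty y∈S)) ]′
                (x∈p∪q⁻ ⁅ x ⁆ S y∈∪))
            (≤-reflexive (∣⁅x⁆∣≡1 x))
      ... | no  x≢i = ≤-trans (p⊆q⇒∣p∣≤∣q∣ λ y∈ →
              let y∈∪ , y∈f = x∈p∩q⁻ (⁅ x ⁆ ∪ S) (fibre i) y∈ in
              x∈p∩q⁺
                ( [ (λ y∈x → contradiction
                       (trans (cong part (sym (x∈⁅y⁆⇒x≡y x y∈x)))
                              (∈-fibre⁻ y∈f)) x≢i) , id ]′
                    (x∈p∪q⁻ ⁅ x ⁆ S y∈∪)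
                , y∈f))
            (thin i)

  -- Four points in distinct fibres form a red 4-subset, so a blue set cannot
  -- contain a transversal of size 4.
  blue-thin : ∀ {X} → Mono blue X → (∀ i → ∣ X ∩ fibre i ∣ ≤ 2) → ∣ X ∣ < 7
  blue-thin {X} mono few = ≰⇒> λ 7≤ →
    let S , S⊆X , ∣S∣≡4 , thin = transversal 4 X few (s≤s 7≤)
        no-pair : ∀ i → ∣ S ∩ fibre i ∣ ≢ 2
        no-pair i two = n≮n 1 (subst (_≤ 1) two (thin i))
        not-inside : ∀ i → ¬ S ⊆ fibre i
        not-inside i S⊆ = n≮n 1 (≤-trans (s≤s (s≤s z≤n))
          (subst (_≤ 1) ∣S∣≡4 (≤-trans
            (p⊆q⇒∣p∣≤∣q∣ λ x∈ → x∈p∩q⁺ (x∈ , S⊆ x∈)) (thin i))))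
        is-red = colour-spread (S , ∣S∣≡4) no-pair not-inside
    in  contradiction (trans (sym is-red) (mono (S , ∣S∣≡4) S⊆X)) λ ()

  blue-descends : ∀ q → m * 2 < q ⊎ 7 ≤ q → HasMonochromatic colour blue q →
                  HasMonochromatic c blue q
  blue-descends q large (X , refl , mono) with crowded-fibre 2 X
  ... | inj₁ (i , three) = mono-in-fibre X (blue-inside i mono three) mono
  ... | inj₂ few = ⊥-elim (
    [ (λ 2m<q → <⇒≱ 2m<q (few-points 2 X few))
    , (λ 7≤q  → <⇒≱ (blue-thin mono few) 7≤q) ]′ large)

-- Descent of the Ramsey property, and the lower bound

ramsey-descends : ∀ {m n N p q} → m ≤ p → m * 2 < q ⊎ 7 ≤ q → N ≤ m * n →
                  RamseyProperty 4 (suc p) q N → RamseyProperty 4 p q n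
ramsey-descends {m} {n} {N} {p} {q} m≤p large N≤mn ramsey c =
  [ inj₁ ∘ red-descends p m≤p , inj₂ ∘ blue-descends q large ]′ (ramsey colour)
  where
  -- The first N of the m * n points, as pairs in Fin m × Fin n.
  place : Fin N → Fin m × Fin n
  place x = remQuot {m} n (inject≤ x N≤mn)

  place-injective : ∀ {x y} → proj₁ (place x) ≡ proj₁ (place y) →
                    proj₂ (place x) ≡ proj₂ (place y) → x ≡ y
  place-injective {x} {y} eq₁ eq₂ = inject≤-injective N≤mn N≤mn x y (begin
    inject≤ x N≤mn            ≡⟨ combine-remQuot {m} n (inject≤ x N≤mn) ⟨
    uncurry combine (place x) ≡⟨ cong₂ combine eq₁ eq₂ ⟩
    uncurry combine (place y) ≡⟨ combine-remQuot {m} n (inject≤ y N≤mn) ⟩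
    inject≤ y N≤mn            ∎)
    where open ≡-Reasoning

  open Product (proj₁ ∘ place) (proj₂ ∘ place) place-injective c

ramsey-positive : ∀ {k p q N} → 0 < p → 0 < q → RamseyProperty k p q N → 0 < N
ramsey-positive 0<p 0<q ramsey with ramsey (λ _ → red)
... | inj₁ (X , refl , _) = ≤-trans 0<p (∣p∣≤n X)
... | inj₂ (X , refl , _) = ≤-trans 0<q (∣p∣≤n X)

ramsey-bound : ∀ {m p q r r′} → m ≤ p → 0 < p → 0 < q → m * 2 < q ⊎ 7 ≤ q →
               IsRamseyNumber 4 (suc p) q r → IsRamseyNumber 4 p q r′ →
               m * (r′ ∸ 1) < r
ramsey-bound {r′ = zero} _ 0<p 0<q _ _ (ramsey′ , _) =
  contradiction (ramsey-positive 0<p 0<q ramsey′) (n≮n 0)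
ramsey-bound {r′ = suc n} m≤p _ _ large (ramsey , _) (_ , least) =
  ≰⇒> λ r≤mn → n≮n n (least n (ramsey-descends m≤p large r≤mn ramsey))

2*r∸1≤ : ∀ r → 2 * r ∸ 1 ≤ suc (2 * (r ∸ 1))
2*r∸1≤ zero    = z≤n
2*r∸1≤ (suc r) = ≤-reflexive (+-suc r (r + 0))

theorem1 : (∀ (p q : ℕ) → p ≥ 6 → q ≥ 5 →
    ∀ (r r′ : ℕ) → IsRamseyNumber 4 p q r → IsRamseyNumber 4 (p ∸ 1) q r′ →
    r ≥ 2 * r′ ∸ 1)
    ×
    (∀ (p q : ℕ) → p ≥ 6 → q ≥ 7 →
    ∀ (r r′ : ℕ) → IsRamseyNumber 4 p q r → IsRamseyNumber 4 (p ∸ 1) q r′ →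
    r ≥ (p ∸ 1) * (r′ ∸ 1) + 1)
theorem1 =
  (λ where
    (suc p) q (s≤s 5≤p) 5≤q r r′ R R′ → ≤-trans (2*r∸1≤ r′)
      (ramsey-bound {m = 2} (≤-trans (s≤s (s≤s z≤n)) 5≤p)
        (≤-trans (s≤s z≤n) 5≤p) (≤-trans (s≤s z≤n) 5≤q) (inj₁ 5≤q) R R′)) ,
  (λ where
    (suc p) q (s≤s 5≤p) 7≤q r r′ R R′ →
      subst (_≤ r) (+-comm 1 (p * (r′ ∸ 1)))
        (ramsey-bound {m = p} ≤-refl
          (≤-trans (s≤s z≤n) 5≤p) (≤-trans (s≤s z≤n) 7≤q) (inj₂ 7≤q) R R′))
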